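{- Fix an integer $k\ge 1$. Let $\chi_k^{\ast}(p,q)$ be the formal power series in $p$ satisfying $$1-(m-1)\chi_{k}^{\ast}(p,q)-pq\prod_{j=0}^{k-1}\chi_{k}^{\ast}(pq^j,q)-pq^2\bigl(m(u-1)+1\bigr)\prod_{j=0}^{k}\chi_{k}^{\ast}(pq^j,q)=0 .$$ Then $$\chi_{k}^{\ast}(p,q)=\sum_{n\ge 0}\frac{(-pq)^{n}}{(m-1)^{(k+1)n+1}}\sum_{\mu\in\mathtt{Sch}^{B}(n;k)}m'^{\,N(H)}(m'u'+u'+1)^{N(U)}q^{d(\mu)},$$ where $N(H)$ and $N(U)$ are the numbers of horizontal and up steps in $\mu$ respectively, and $$d(\mu)=\mathrm{Area}(\widetilde{\mu})+n-N(H).$$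
   Context: The quantities $m,u,q$ are formal variables with $m-1$ invertible; $m'=m-1$ and $u'=u-1$, and power series in $p$ have coefficients in $\mathbb{Q}[m,u,q,(m-1)^{ -1}]$. A $k$-Schröder path of type B of size $n$ is a lattice path from $(0,0)$ to $(kn,n)$ consisting of up steps $U=(0,1)$, down steps $D=(1,0)$ and horizontal steps $H=(1,1)$, which never goes below the line $y=x/k$; $\mathtt{Sch}^{B}(n;k)$ is the set of them. A $k$-Dyck path is such a path with no $H$ steps. For $\mu\in\mathtt{Sch}^{B}(n;k)$, $\widetilde{\mu}$ is the $k$-Dyck path obtained from $\mu$ by replacing each $H$ by $UD$. For a $k$-Dyck path $\lambda$ of size $n$, $\mathrm{Area}(\lambda)$ is the number of unit boxes below $\lambda$ and above the lowest $k$-Dyck path $(UD^k)^n$. -}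

module Defs where

open import Algebra.Bundles using (CommutativeRing)
open import Data.List.Base using (List; []; _∷_; _++_; map; concat; concatMap; replicate; foldr; filter; length; upTo; applyUpTo; cartesianProduct)
open import Data.List.Relation.Unary.All using (All; all?)
open import Data.List.Relation.Unary.Any using (Any; any?)
open import Data.Nat.Base as ℕ using (ℕ; zero; suc; _∸_; _≤_; _<_)
import Data.Nat.Properties as ℕ
open import Data.Product.Base using (_×_; _,_)
open import Data.Rational.Base as ℚ using (ℚ; 0ℚ; 1ℚ)
open import Level using (0ℓ)
open import Relation.Binary.PropositionalEquality.Core using (_≡_; refl)
open import Relation.Nullary.Decidable using (Dec; yes; no; _×-dec_)
import Relation.Unary as Unary

------------------------------------------------------------------------
-- The coefficient ring ℚ[m,u,q,(m-1)⁻¹]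

-- The ring is given by its presentation as a commutative ℚ-algebra:
-- generators m, u, q, r with the single relation (m - 1) r = 1.
-- Elements are ring expressions, and equality is the least congruence
-- containing the commutative ring laws, the arithmetic of the scalars
-- in ℚ, and that relation.

module Presentation where

  infixl 6 _⊕_
  infixl 7 _⊗_
  infix  8 ⊖_
  infix  4 _≋_

  data Term : Set where
    scalar          : ℚ → Term
    ‵m ‵u ‵q ‵r     : Term
    _⊕_ _⊗_         : Term → Term → Term
    ⊖_              : Term → Term

  data _≋_ : Term → Term → Set where
    ≋-refl  : ∀ {x} → x ≋ x
    ≋-sym   : ∀ {x y} → x ≋ y → y ≋ x
    ≋-trans : ∀ {x y z} → x ≋ y → y ≋ z → x ≋ z

    ⊕-cong : ∀ {x x′ y y′} → x ≋ x′ → y ≋ y′ → x ⊕ y ≋ x′ ⊕ y′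
    ⊗-cong : ∀ {x x′ y y′} → x ≋ x′ → y ≋ y′ → x ⊗ y ≋ x′ ⊗ y′
    ⊖-cong : ∀ {x x′} → x ≋ x′ → ⊖ x ≋ ⊖ x′

    ⊕-assoc     : ∀ x y z → (x ⊕ y) ⊕ z ≋ x ⊕ (y ⊕ z)
    ⊕-comm      : ∀ x y → x ⊕ y ≋ y ⊕ x
    ⊕-identityˡ : ∀ x → scalar 0ℚ ⊕ x ≋ x
    ⊖-inverseˡ  : ∀ x → (⊖ x) ⊕ x ≋ scalar 0ℚ
    ⊗-assoc     : ∀ x y z → (x ⊗ y) ⊗ z ≋ x ⊗ (y ⊗ z)
    ⊗-comm      : ∀ x y → x ⊗ y ≋ y ⊗ x
    ⊗-identityˡ : ∀ x → scalar 1ℚ ⊗ x ≋ x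
    distribˡ    : ∀ x y z → x ⊗ (y ⊕ z) ≋ (x ⊗ y) ⊕ (x ⊗ z)

    scalar-+ : ∀ a b → scalar (a ℚ.+ b) ≋ scalar a ⊕ scalar b
    scalar-* : ∀ a b → scalar (a ℚ.* b) ≋ scalar a ⊗ scalar b

    r-inverse : (‵m ⊕ (⊖ scalar 1ℚ)) ⊗ ‵r ≋ scalar 1ℚ

  commutativeRing : CommutativeRing 0ℓ 0ℓ
  commutativeRing = record
    { Carrier = Term ; _≈_ = _≋_ ; _+_ = _⊕_ ; _*_ = _⊗_ ; -_ = ⊖_
    ; 0# = scalar 0ℚ ; 1# = scalar 1ℚ
    ; isCommutativeRing = record
      { isRing = record
        { +-isAbelianGroup = record
          { isGroup = record
            { isMonoid = record
              { isSemigroup = record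
                { isMagma = record
                  { isEquivalence = record
                    { refl = ≋-refl ; sym = ≋-sym ; trans = ≋-trans }
                  ; ∙-cong = ⊕-cong }
                ; assoc = ⊕-assoc }
              ; identity = ⊕-identityˡ
                         , λ x → ≋-trans (⊕-comm _ _) (⊕-identityˡ x) }
            ; inverse = ⊖-inverseˡ
                      , λ x → ≋-trans (⊕-comm _ _) (⊖-inverseˡ x)
            ; ⁻¹-cong = ⊖-cong }
          ; comm = ⊕-comm }
        ; *-cong = ⊗-cong
        ; *-assoc = ⊗-assoc
        ; *-identity = ⊗-identityˡ
                     , λ x → ≋-trans (⊗-comm _ _) (⊗-identityˡ x)
        ; distrib = distribˡ
                  , λ x y z → ≋-trans (⊗-comm _ _)
                      (≋-trans (distribˡ x y z) (⊕-cong (⊗-comm _ _) (⊗-comm _ _)))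
        }
      ; *-comm = ⊗-comm
      }
    }

𝕂 : CommutativeRing 0ℓ 0ℓ
𝕂 = Presentation.commutativeRing

open CommutativeRing 𝕂 public
  using (_≈_; _+_; _-_; _*_; -_; 0#; 1#)
  renaming (Carrier to K)

open import Algebra.Properties.Semiring.Exp (CommutativeRing.semiring 𝕂) public
  using (_^_)

m u q : K
m = Presentation.‵m
u = Presentation.‵u
q = Presentation.‵q

m′ u′ : K
m′ = m - 1#
u′ = u - 1#

1/m′ : K
1/m′ = Presentation.‵r

∑ : ∀ {A : Set} → List A → (A → K) → K
∑ xs f = foldr _+_ 0# (map f xs)

syntax ∑ xs (λ x → e) = ∑[ x ← xs ] e

------------------------------------------------------------------------
-- Formal power series in p over K, as coefficient sequences

Series : Set
Series = ℕ → K

infix  4 _≈ₚ_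
infixl 6 _-ₚ_
infixl 7 _*ₚ_

_≈ₚ_ : Series → Series → Set
f ≈ₚ g = ∀ n → f n ≈ g n

const : K → Series
const c zero    = c
const c (suc _) = 0#

0ₚ 1ₚ : Series
0ₚ = const 0#
1ₚ = const 1#

p : Series
p 1 = 1#
p _ = 0#

_-ₚ_ : Series → Series → Series
(f -ₚ g) n = f n - g n

_*ₚ_ : Series → Series → Series
(f *ₚ g) n = ∑[ i ← upTo (suc n) ] (f i * g (n ∸ i))

-- f ⟨p· c ⟩ is the series f(pc).
infix 9 _⟨p·_⟩

_⟨p·_⟩ : Series → K → Series
(f ⟨p· c ⟩) n = c ^ n * f n

∏ₚ : ℕ → (ℕ → Series) → Series
∏ₚ k f = foldr _*ₚ_ 1ₚ (applyUpTo f k)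

infix 8 ∏ₚ

syntax ∏ₚ k (λ j → f) = ∏ₚ[ j < k ] f

------------------------------------------------------------------------
-- Lattice paths

data Step : Set where
  U D H : Step

_≟_ : (s t : Step) → Dec (s ≡ t)
U ≟ U = yes refl
U ≟ D = no λ ()
U ≟ H = no λ ()
D ≟ U = no λ ()
D ≟ D = yes refl
D ≟ H = no λ ()
H ≟ U = no λ ()
H ≟ D = no λ ()
H ≟ H = yes refl

Path : Set
Path = List Step

N : Step → Path → ℕ
N s μ = length (filter (s ≟_) μ)

Point : Set
Point = ℕ × ℕ

move : Step → Point → Point
move U (x , y) = x     , suc y
move D (x , y) = suc x , y
move H (x , y) = suc x , suc y

-- The lattice points visited by a path that starts at the given point.
pointsFrom : Point → Path → List Point
pointsFrom P []      = P ∷ []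
pointsFrom P (s ∷ μ) = P ∷ pointsFrom (move s P) μ

points : Path → List Point
points = pointsFrom (0 , 0)

-- All paths from (0,0) to (a,b).
latticePaths : ℕ → ℕ → List Path
latticePaths zero    zero    = [] ∷ []
latticePaths zero    (suc b) = map (U ∷_) (latticePaths zero b)
latticePaths (suc a) zero    = map (D ∷_) (latticePaths a zero)
latticePaths (suc a) (suc b) =
     map (U ∷_) (latticePaths (suc a) b)
  ++ map (D ∷_) (latticePaths a (suc b))
  ++ map (H ∷_) (latticePaths a b)

-- The path never goes below the line y = x/k.  As a half plane is
-- convex, it suffices to look at the endpoints of the steps.
AboveLine : ℕ → Path → Set
AboveLine k μ = All (λ (x , y) → x ≤ k ℕ.* y) (points μ)

aboveLine? : ∀ k → Unary.Decidable (AboveLine k)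
aboveLine? k μ = all? (λ (x , y) → x ℕ.≤? k ℕ.* y) (points μ)

-- The set of k-Schröder paths of type B of size n, listed without
-- repetition.
SchB : ℕ → ℕ → List Path
SchB n k = filter (aboveLine? k) (latticePaths (k ℕ.* n) n)

-- μ̃
tilde : Path → Path
tilde = concatMap λ where
  U → U ∷ []
  D → D ∷ []
  H → U ∷ D ∷ []

-- The lowest k-Dyck path (U Dᵏ)ⁿ.
lowest : ℕ → ℕ → Path
lowest k n = concat (replicate n (U ∷ replicate k D))

-- (i , j) denotes the unit box [i,i+1] × [j,j+1].  Steps go north and
-- east, so a box lies below a path iff the path visits a point weakly
-- north-west of the box's top left corner (i,j+1), and above it iff the
-- path visits a point weakly south-east of the bottom right corner (i+1,j).
BoxBelow BoxAbove : Path → Point → Set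
BoxBelow ν (i , j) = Any (λ (x , y) → x ≤ i × j < y) (points ν)
BoxAbove ν (i , j) = Any (λ (x , y) → i < x × y ≤ j) (points ν)

boxBelow? : ∀ ν → Unary.Decidable (BoxBelow ν)
boxBelow? ν (i , j) = any? (λ (x , y) → x ℕ.≤? i ×-dec j ℕ.<? y) (points ν)

boxAbove? : ∀ ν → Unary.Decidable (BoxAbove ν)
boxAbove? ν (i , j) = any? (λ (x , y) → i ℕ.<? x ×-dec y ℕ.≤? j) (points ν)

-- Area of a k-Dyck path of size n; both paths stay in [0,kn] × [0,n].
Area : ℕ → ℕ → Path → ℕ
Area k n ν =
  length (filter (λ b → boxBelow? ν b ×-dec boxAbove? (lowest k n) b)
                 (cartesianProduct (upTo (k ℕ.* n)) (upTo n)))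

-- The subtraction is exact: every H raises a path by one, so N H μ ≤ n.
d : ℕ → ℕ → Path → ℕ
d k n μ = (Area k n (tilde μ) ℕ.+ n) ∸ N H μ

{-# OPTIONS --safe #-}
module Submission where

-- Put Q_e(p) = χ(p) χ(pq) ⋯ χ(pq^(e-1)).  Multiplying the functional equation at
-- pq^e by Q_e gives  m′ Q_(e+1) = Q_e − p q^(e+1) (Q_(e+k) + q w Q_(e+k+1)),
-- w = m′u′ + u′ + 1.  Up to the factors (-q)^n and (m-1)⁻¹, this is the recursion
-- by the first step for weighted paths that start at excess e = k y − x above the
-- line: D lowers the excess by 1, H raises it by k − 1 and U by k.  Since a
-- k-Dyck path has k y − x boxes in the row of an up step at (x , y), a first U or
-- H contributes q^e to q^Area.

open import Defs
open import Data.Nat using (ℕ; suc; _≤_) renaming (_+_ to _+ℕ_; _*_ to _*ℕ_)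
open import Algebra.Bundles using (CommutativeRing)
import Algebra.Properties.CommutativeSemigroup as CommutativeSemigroupProperties
open import Data.Bool.Base using (true; false)
open import Data.List.Base using (List; []; _∷_; _++_; map; foldr; filter; length; replicate; upTo; cartesianProduct)
open import Data.List.Properties using (map-upTo; map-applyUpTo; map-cong-local; length-++; filter-all; filter-none; filter-++; filter-≐)
open import Data.List.Relation.Unary.All as All using (All; []; _∷_; all?; lookupAny)
open import Data.List.Relation.Unary.All.Properties using (map⁺; ++⁺; filter⁺)
open import Data.List.Relation.Unary.Any as Any using (Any; here; there; any?)
open import Data.Nat using (zero; _<_; _∸_; _⊓_; z≤n; s≤s)
open import Data.Nat.ListAction using (sum)
import Data.Nat.Properties as ℕ
import Data.Nat.Solver as NatSolver
open import Data.Product.Base using (_×_; _,_; proj₁)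
open import Function.Base using (_∘_)
open import Function.Bundles using (_⇔_; mk⇔; Equivalence)
open import Relation.Binary.PropositionalEquality as ≡ using (_≡_; cong; cong₂)
import Relation.Binary.Reasoning.Setoid as SetoidReasoning
open import Relation.Nullary.Decidable using (does; _×-dec_)
open import Relation.Nullary.Negation using (¬_; contradiction)
open import Relation.Unary using (Decidable)

open CommutativeRing 𝕂 using
  ( setoid; ring; commutativeSemiring; reflexive; +-cong; +-congˡ; +-congʳ; +-assoc; +-identityˡ; +-identityʳ
  ; *-cong; *-congˡ; *-congʳ; *-assoc; *-identityˡ; *-identityʳ; zeroˡ; zeroʳ; distribˡ; -‿cong; -‿inverseˡ )
  renaming (refl to ≈-refl; sym to ≈-sym; trans to ≈-trans)
open import Algebra.Properties.CommutativeSemiring.Exp commutativeSemiring using (^-homo-*; ^-distrib-*; ^-congˡ; ^-congʳ)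
open import Algebra.Properties.Ring ring using (-0#≈0#; -‿distribˡ-*)
open import Algebra.Solver.Ring.NaturalCoefficients.Default commutativeSemiring using (solve; _:=_; _:+_; _:*_; con)
open CommutativeSemigroupProperties ℕ.+-commutativeSemigroup using () renaming (x∙yz≈y∙xz to x+[y+z]≡y+[x+z])

-- The equation is nonlinear in χ, and no recursion for the coefficients of χ alone is in sight. The
-- identity Q_i(p) Q_j(pq^i) = Q_(i+j)(p) makes it linear in the whole family Q_e, so that all
-- coefficients are determined together, by induction on the power of p and then on e; χ itself is
-- Q_1. The index is the excess plus one. Since D lowers the excess by exactly 1, a path from excess
-- e - 1 down to 0 splits into e excursions, one above each level j < e. Raising an excursion by j
-- multiplies each of its U and H weights by q^j, which is the substitution of pq^j for p. This is
-- why a product of e dilated copies of χ counts such paths; the proof itself only compares the two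
-- recursions.

module ℕS = NatSolver.+-*-Solver
module K-Reasoning = SetoidReasoning setoid

-- The Cauchy product

*ₚ-head : ∀ f g → (f *ₚ g) 0 ≈ f 0 * g 0
*ₚ-head f g = +-identityʳ _

-- Peels off the summand with i = 0. The inductive laws below rest on it, with `f ∘ suc` in place of
-- `f`, so no double sum is ever reindexed.
*ₚ-tail : ∀ f g n → (f *ₚ g) (suc n) ≈ f 0 * g (suc n) + ((f ∘ suc) *ₚ g) n
*ₚ-tail f g n = reflexive (cong (λ xs → f 0 * g (suc n) + foldr _+_ 0# xs)
  (≡.trans (map-applyUpTo suc _ (suc n)) (≡.sym (map-upTo _ (suc n)))))

*ₚ-cong : ∀ {f f′ g g′} → f ≈ₚ f′ → g ≈ₚ g′ → f *ₚ g ≈ₚ f′ *ₚ g′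
*ₚ-cong {f} {f′} {g} {g′} f≈f′ g≈g′ zero = +-congʳ (*-cong (f≈f′ 0) (g≈g′ 0))
*ₚ-cong {f} {f′} {g} {g′} f≈f′ g≈g′ (suc n) = begin
  (f *ₚ g) (suc n)                          ≈⟨ *ₚ-tail f g n ⟩
  f 0 * g (suc n) + ((f ∘ suc) *ₚ g) n      ≈⟨ +-cong (*-cong (f≈f′ 0) (g≈g′ (suc n))) (*ₚ-cong (f≈f′ ∘ suc) g≈g′ n) ⟩
  f′ 0 * g′ (suc n) + ((f′ ∘ suc) *ₚ g′) n  ≈⟨ *ₚ-tail f′ g′ n ⟨
  (f′ *ₚ g′) (suc n)                        ∎
  where open K-Reasoning

infixl 6 _+ₚ_
infixl 7 _·ₚ_

_+ₚ_ : Series → Series → Series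
(f +ₚ g) n = f n + g n

_·ₚ_ : K → Series → Series
(c ·ₚ f) n = c * f n

*ₚ-·ˡ : ∀ c f g → (c ·ₚ f) *ₚ g ≈ₚ c ·ₚ (f *ₚ g)
*ₚ-·ˡ c f g zero = begin
  ((c ·ₚ f) *ₚ g) 0  ≈⟨ *ₚ-head (c ·ₚ f) g ⟩
  c * f 0 * g 0      ≈⟨ *-assoc c (f 0) (g 0) ⟩
  c * (f 0 * g 0)    ≈⟨ *-congˡ (*ₚ-head f g) ⟨
  c * (f *ₚ g) 0     ∎
  where open K-Reasoning
*ₚ-·ˡ c f g (suc n) = begin
  ((c ·ₚ f) *ₚ g) (suc n)                            ≈⟨ *ₚ-tail (c ·ₚ f) g n ⟩
  c * f 0 * g (suc n) + ((c ·ₚ (f ∘ suc)) *ₚ g) n    ≈⟨ +-congˡ (*ₚ-·ˡ c (f ∘ suc) g n) ⟩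
  c * f 0 * g (suc n) + c * ((f ∘ suc) *ₚ g) n
    ≈⟨ solve 4 (λ c f g h → c :* f :* g :+ c :* h := c :* (f :* g :+ h)) ≈-refl c (f 0) (g (suc n)) _ ⟩
  c * (f 0 * g (suc n) + ((f ∘ suc) *ₚ g) n)         ≈⟨ *-congˡ (*ₚ-tail f g n) ⟨
  c * (f *ₚ g) (suc n)                               ∎
  where open K-Reasoning

*ₚ-·ʳ : ∀ c f g → f *ₚ (c ·ₚ g) ≈ₚ c ·ₚ (f *ₚ g)
*ₚ-·ʳ c f g zero = begin
  (f *ₚ (c ·ₚ g)) 0  ≈⟨ *ₚ-head f (c ·ₚ g) ⟩
  f 0 * (c * g 0)    ≈⟨ solve 3 (λ c f g → f :* (c :* g) := c :* (f :* g)) ≈-refl c (f 0) (g 0) ⟩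
  c * (f 0 * g 0)    ≈⟨ *-congˡ (*ₚ-head f g) ⟨
  c * (f *ₚ g) 0     ∎
  where open K-Reasoning
*ₚ-·ʳ c f g (suc n) = begin
  (f *ₚ (c ·ₚ g)) (suc n)                            ≈⟨ *ₚ-tail f (c ·ₚ g) n ⟩
  f 0 * (c * g (suc n)) + ((f ∘ suc) *ₚ (c ·ₚ g)) n  ≈⟨ +-congˡ (*ₚ-·ʳ c (f ∘ suc) g n) ⟩
  f 0 * (c * g (suc n)) + c * ((f ∘ suc) *ₚ g) n
    ≈⟨ solve 4 (λ c f g h → f :* (c :* g) :+ c :* h := c :* (f :* g :+ h)) ≈-refl c (f 0) (g (suc n)) _ ⟩
  c * (f 0 * g (suc n) + ((f ∘ suc) *ₚ g) n)         ≈⟨ *-congˡ (*ₚ-tail f g n) ⟨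
  c * (f *ₚ g) (suc n)                               ∎
  where open K-Reasoning

*ₚ-distribˡ : ∀ f g h → f *ₚ (g +ₚ h) ≈ₚ f *ₚ g +ₚ f *ₚ h
*ₚ-distribˡ f g h zero =
  solve 3 (λ f g h → f :* (g :+ h) :+ con 0 := (f :* g :+ con 0) :+ (f :* h :+ con 0)) ≈-refl (f 0) (g 0) (h 0)
*ₚ-distribˡ f g h (suc n) = begin
  (f *ₚ (g +ₚ h)) (suc n)
    ≈⟨ *ₚ-tail f (g +ₚ h) n ⟩
  f 0 * (g (suc n) + h (suc n)) + ((f ∘ suc) *ₚ (g +ₚ h)) n
    ≈⟨ +-congˡ (*ₚ-distribˡ (f ∘ suc) g h n) ⟩
  f 0 * (g (suc n) + h (suc n)) + (((f ∘ suc) *ₚ g) n + ((f ∘ suc) *ₚ h) n)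
    ≈⟨ solve 5 (λ f g h a b → f :* (g :+ h) :+ (a :+ b) := (f :* g :+ a) :+ (f :* h :+ b)) ≈-refl
         (f 0) (g (suc n)) (h (suc n)) _ _ ⟩
  (f 0 * g (suc n) + ((f ∘ suc) *ₚ g) n) + (f 0 * h (suc n) + ((f ∘ suc) *ₚ h) n)
    ≈⟨ +-cong (*ₚ-tail f g n) (*ₚ-tail f h n) ⟨
  (f *ₚ g) (suc n) + (f *ₚ h) (suc n)  ∎
  where open K-Reasoning

*ₚ-distribʳ : ∀ f g h → (f +ₚ g) *ₚ h ≈ₚ f *ₚ h +ₚ g *ₚ h
*ₚ-distribʳ f g h zero =
  solve 3 (λ f g h → (f :+ g) :* h :+ con 0 := (f :* h :+ con 0) :+ (g :* h :+ con 0)) ≈-refl (f 0) (g 0) (h 0)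
*ₚ-distribʳ f g h (suc n) = begin
  ((f +ₚ g) *ₚ h) (suc n)
    ≈⟨ *ₚ-tail (f +ₚ g) h n ⟩
  (f 0 + g 0) * h (suc n) + (((f ∘ suc) +ₚ (g ∘ suc)) *ₚ h) n
    ≈⟨ +-congˡ (*ₚ-distribʳ (f ∘ suc) (g ∘ suc) h n) ⟩
  (f 0 + g 0) * h (suc n) + (((f ∘ suc) *ₚ h) n + ((g ∘ suc) *ₚ h) n)
    ≈⟨ solve 5 (λ f g h a b → (f :+ g) :* h :+ (a :+ b) := (f :* h :+ a) :+ (g :* h :+ b)) ≈-refl
         (f 0) (g 0) (h (suc n)) _ _ ⟩
  (f 0 * h (suc n) + ((f ∘ suc) *ₚ h) n) + (g 0 * h (suc n) + ((g ∘ suc) *ₚ h) n)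
    ≈⟨ +-cong (*ₚ-tail f h n) (*ₚ-tail g h n) ⟨
  (f *ₚ h) (suc n) + (g *ₚ h) (suc n)  ∎
  where open K-Reasoning

*ₚ-assoc : ∀ f g h → (f *ₚ g) *ₚ h ≈ₚ f *ₚ (g *ₚ h)
*ₚ-assoc f g h zero =
  solve 3 (λ f g h → (f :* g :+ con 0) :* h :+ con 0 := f :* (g :* h :+ con 0) :+ con 0) ≈-refl (f 0) (g 0) (h 0)
*ₚ-assoc f g h (suc n) = begin
  ((f *ₚ g) *ₚ h) (suc n)
    ≈⟨ *ₚ-tail (f *ₚ g) h n ⟩
  (f *ₚ g) 0 * h (suc n) + (((f *ₚ g) ∘ suc) *ₚ h) n
    -- Read as an identity of series, `*ₚ-tail` splits the tail of `f *ₚ g` into a scalar multiple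
    -- of `g ∘ suc` and a product to which induction applies.
    ≈⟨ +-cong (*-congʳ (*ₚ-head f g)) (*ₚ-cong {g = h} (*ₚ-tail f g) (λ _ → ≈-refl) n) ⟩
  f 0 * g 0 * h (suc n) + ((f 0 ·ₚ (g ∘ suc) +ₚ (f ∘ suc) *ₚ g) *ₚ h) n
    ≈⟨ +-congˡ (*ₚ-distribʳ (f 0 ·ₚ (g ∘ suc)) ((f ∘ suc) *ₚ g) h n) ⟩
  f 0 * g 0 * h (suc n) + (((f 0 ·ₚ (g ∘ suc)) *ₚ h) n + (((f ∘ suc) *ₚ g) *ₚ h) n)
    ≈⟨ +-congˡ (+-cong (*ₚ-·ˡ (f 0) (g ∘ suc) h n) (*ₚ-assoc (f ∘ suc) g h n)) ⟩
  f 0 * g 0 * h (suc n) + (f 0 * ((g ∘ suc) *ₚ h) n + ((f ∘ suc) *ₚ (g *ₚ h)) n)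
    ≈⟨ solve 5 (λ f g h a b → f :* g :* h :+ (f :* a :+ b) := f :* (g :* h :+ a) :+ b) ≈-refl
         (f 0) (g 0) (h (suc n)) _ _ ⟩
  f 0 * (g 0 * h (suc n) + ((g ∘ suc) *ₚ h) n) + ((f ∘ suc) *ₚ (g *ₚ h)) n
    ≈⟨ +-congʳ (*-congˡ (*ₚ-tail g h n)) ⟨
  f 0 * (g *ₚ h) (suc n) + ((f ∘ suc) *ₚ (g *ₚ h)) n
    ≈⟨ *ₚ-tail f (g *ₚ h) n ⟨
  (f *ₚ (g *ₚ h)) (suc n)  ∎
  where open K-Reasoning

*ₚ-zeroˡ : ∀ f n → ((λ _ → 0#) *ₚ f) n ≈ 0#
*ₚ-zeroˡ f zero = ≈-trans (*ₚ-head (λ _ → 0#) f) (zeroˡ (f 0))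
*ₚ-zeroˡ f (suc n) = ≈-trans (*ₚ-tail (λ _ → 0#) f n)
  (≈-trans (+-cong (zeroˡ (f (suc n))) (*ₚ-zeroˡ f n)) (+-identityˡ 0#))

const-*ₚ : ∀ c f → const c *ₚ f ≈ₚ c ·ₚ f
const-*ₚ c f zero = *ₚ-head (const c) f
const-*ₚ c f (suc n) = ≈-trans (*ₚ-tail (const c) f n)
  (≈-trans (+-congˡ (*ₚ-zeroˡ f n)) (+-identityʳ _))

*ₚ-identityˡ : ∀ f → 1ₚ *ₚ f ≈ₚ f
*ₚ-identityˡ f n = ≈-trans (const-*ₚ 1# f n) (*-identityˡ (f n))

*ₚ-identityʳ : ∀ f → f *ₚ 1ₚ ≈ₚ f
*ₚ-identityʳ f zero = ≈-trans (*ₚ-head f 1ₚ) (*-identityʳ (f 0))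
*ₚ-identityʳ f (suc n) = ≈-trans (*ₚ-tail f 1ₚ n)
  (≈-trans (+-cong (zeroʳ (f 0)) (*ₚ-identityʳ (f ∘ suc) n)) (+-identityˡ _))

-- Multiplication by p

shift : Series → Series
shift f zero    = 0#
shift f (suc n) = f n

shift-cong : ∀ {f g} → f ≈ₚ g → shift f ≈ₚ shift g
shift-cong f≈g zero    = ≈-refl
shift-cong f≈g (suc n) = f≈g n

p-*ₚ : ∀ f → p *ₚ f ≈ₚ shift f
p-*ₚ f zero = ≈-trans (*ₚ-head p f) (zeroˡ (f 0))
p-*ₚ f (suc n) = begin
  (p *ₚ f) (suc n)                      ≈⟨ *ₚ-tail p f n ⟩
  0# * f (suc n) + ((p ∘ suc) *ₚ f) n   ≈⟨ +-cong (zeroˡ (f (suc n))) (*ₚ-cong {g = f} p∘suc≈1ₚ (λ _ → ≈-refl) n) ⟩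
  0# + (1ₚ *ₚ f) n                      ≈⟨ +-identityˡ _ ⟩
  (1ₚ *ₚ f) n                           ≈⟨ *ₚ-identityˡ f n ⟩
  f n                                   ∎
  where
  open K-Reasoning
  p∘suc≈1ₚ : p ∘ suc ≈ₚ 1ₚ
  p∘suc≈1ₚ zero    = ≈-refl
  p∘suc≈1ₚ (suc _) = ≈-refl

-- Brings the p of a right operand to the front, as required when the equation at pq^e is multiplied
-- by Q_e from the left.
*ₚ-shift : ∀ f g → f *ₚ shift g ≈ₚ shift (f *ₚ g)
*ₚ-shift f g zero = ≈-trans (*ₚ-head f (shift g)) (zeroʳ (f 0))
*ₚ-shift f g (suc zero) = begin
  (f *ₚ shift g) 1                          ≈⟨ *ₚ-tail f (shift g) 0 ⟩
  f 0 * g 0 + ((f ∘ suc) *ₚ shift g) 0      ≈⟨ +-congˡ (*ₚ-shift (f ∘ suc) g 0) ⟩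
  f 0 * g 0 + 0#                            ∎
  where open K-Reasoning
*ₚ-shift f g (suc (suc n)) = begin
  (f *ₚ shift g) (suc (suc n))                         ≈⟨ *ₚ-tail f (shift g) (suc n) ⟩
  f 0 * g (suc n) + ((f ∘ suc) *ₚ shift g) (suc n)     ≈⟨ +-congˡ (*ₚ-shift (f ∘ suc) g (suc n)) ⟩
  f 0 * g (suc n) + ((f ∘ suc) *ₚ g) n                 ≈⟨ *ₚ-tail f g n ⟨
  (f *ₚ g) (suc n)                                     ∎
  where open K-Reasoning

-- Dilations of p and finite products

⟨p·⟩-*ₚ : ∀ f g c → (f *ₚ g) ⟨p· c ⟩ ≈ₚ f ⟨p· c ⟩ *ₚ g ⟨p· c ⟩
⟨p·⟩-*ₚ f g c zero = begin
  1# * (f *ₚ g) 0               ≈⟨ *-congˡ (*ₚ-head f g) ⟩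
  1# * (f 0 * g 0)              ≈⟨ solve 2 (λ f g → con 1 :* (f :* g) := (con 1 :* f) :* (con 1 :* g)) ≈-refl (f 0) (g 0) ⟩
  (1# * f 0) * (1# * g 0)       ≈⟨ *ₚ-head (f ⟨p· c ⟩) (g ⟨p· c ⟩) ⟨
  (f ⟨p· c ⟩ *ₚ g ⟨p· c ⟩) 0    ∎
  where open K-Reasoning
⟨p·⟩-*ₚ f g c (suc n) = begin
  c ^ suc n * (f *ₚ g) (suc n)
    ≈⟨ *-congˡ (*ₚ-tail f g n) ⟩
  c * c ^ n * (f 0 * g (suc n) + ((f ∘ suc) *ₚ g) n)
    ≈⟨ solve 5 (λ c cⁿ f g h → c :* cⁿ :* (f :* g :+ h) := con 1 :* f :* (c :* cⁿ :* g) :+ c :* (cⁿ :* h)) ≈-refl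
         c (c ^ n) (f 0) (g (suc n)) _ ⟩
  1# * f 0 * (c * c ^ n * g (suc n)) + c * (c ^ n * ((f ∘ suc) *ₚ g) n)
    ≈⟨ +-congˡ (*-congˡ (⟨p·⟩-*ₚ (f ∘ suc) g c n)) ⟩
  1# * f 0 * (c * c ^ n * g (suc n)) + c * ((f ∘ suc) ⟨p· c ⟩ *ₚ g ⟨p· c ⟩) n
    ≈⟨ +-congˡ (*ₚ-·ˡ c ((f ∘ suc) ⟨p· c ⟩) (g ⟨p· c ⟩) n) ⟨
  1# * f 0 * (c * c ^ n * g (suc n)) + ((c ·ₚ (f ∘ suc) ⟨p· c ⟩) *ₚ g ⟨p· c ⟩) n
    ≈⟨ +-congˡ (*ₚ-cong {g = g ⟨p· c ⟩} (λ i → *-assoc c (c ^ i) (f (suc i))) (λ _ → ≈-refl) n) ⟨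
  1# * f 0 * (c * c ^ n * g (suc n)) + (((f ⟨p· c ⟩) ∘ suc) *ₚ g ⟨p· c ⟩) n
    ≈⟨ *ₚ-tail (f ⟨p· c ⟩) (g ⟨p· c ⟩) n ⟨
  (f ⟨p· c ⟩ *ₚ g ⟨p· c ⟩) (suc n)  ∎
  where open K-Reasoning

⟨p·⟩-⟨p·⟩ : ∀ f c i j → f ⟨p· c ^ j ⟩ ⟨p· c ^ i ⟩ ≈ₚ f ⟨p· c ^ (i +ℕ j) ⟩
⟨p·⟩-⟨p·⟩ f c i j n = begin
  (c ^ i) ^ n * ((c ^ j) ^ n * f n)    ≈⟨ *-assoc _ _ (f n) ⟨
  (c ^ i) ^ n * (c ^ j) ^ n * f n      ≈⟨ *-congʳ (^-distrib-* (c ^ i) (c ^ j) n) ⟨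
  (c ^ i * c ^ j) ^ n * f n            ≈⟨ *-congʳ (^-congˡ n (^-homo-* c i j)) ⟨
  (c ^ (i +ℕ j)) ^ n * f n             ∎
  where open K-Reasoning

∏ₚ-cong : ∀ k {f g : ℕ → Series} → (∀ j → f j ≈ₚ g j) → ∏ₚ k f ≈ₚ ∏ₚ k g
∏ₚ-cong zero    f≈g n = ≈-refl
∏ₚ-cong (suc k) f≈g = *ₚ-cong (f≈g 0) (∏ₚ-cong k (f≈g ∘ suc))

∏ₚ-+ : ∀ i j f → ∏ₚ (i +ℕ j) f ≈ₚ ∏ₚ i f *ₚ ∏ₚ j (f ∘ (i +ℕ_))
∏ₚ-+ zero    j f n = ≈-sym (*ₚ-identityˡ (∏ₚ j f) n)
∏ₚ-+ (suc i) j f n = ≈-trans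
  (*ₚ-cong {f = f 0} (λ _ → ≈-refl) (∏ₚ-+ i j (f ∘ suc)) n)
  (≈-sym (*ₚ-assoc (f 0) (∏ₚ i (f ∘ suc)) (∏ₚ j (f ∘ (suc i +ℕ_))) n))

∏ₚ-suc : ∀ k f → ∏ₚ (suc k) f ≈ₚ ∏ₚ k f *ₚ f k
∏ₚ-suc zero    f n = ≈-trans (*ₚ-identityʳ (f 0) n) (≈-sym (*ₚ-identityˡ (f 0) n))
∏ₚ-suc (suc k) f n = ≈-trans
  (*ₚ-cong {f = f 0} (λ _ → ≈-refl) (∏ₚ-suc k (f ∘ suc)) n)
  (≈-sym (*ₚ-assoc (f 0) (∏ₚ k (f ∘ suc)) (f (suc k)) n))

⟨p·⟩-∏ₚ : ∀ k f c → (∏ₚ k f) ⟨p· c ⟩ ≈ₚ ∏ₚ[ j < k ] (f j ⟨p· c ⟩)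
⟨p·⟩-∏ₚ zero    f c zero    = *-identityˡ 1#
⟨p·⟩-∏ₚ zero    f c (suc n) = zeroʳ _
⟨p·⟩-∏ₚ (suc k) f c n = ≈-trans (⟨p·⟩-*ₚ (f 0) (∏ₚ k (f ∘ suc)) c n)
  (*ₚ-cong {f = f 0 ⟨p· c ⟩} (λ _ → ≈-refl) (⟨p·⟩-∏ₚ k (f ∘ suc) c) n)

-- The functional equation

qProduct : Series → ℕ → Series
qProduct χ e = ∏ₚ[ j < e ] (χ ⟨p· q ^ j ⟩)

-- The dilation by q^i moves the factors of Q_j to the positions i, ..., i + j - 1, exactly where
-- those of Q_i stop.
qProduct-+ : ∀ χ i j → qProduct χ (i +ℕ j) ≈ₚ qProduct χ i *ₚ (qProduct χ j) ⟨p· q ^ i ⟩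
qProduct-+ χ i j n = ≈-trans (∏ₚ-+ i j _ n)
  (*ₚ-cong {f = qProduct χ i} (λ _ → ≈-refl)
    (λ n → ≈-sym (≈-trans (⟨p·⟩-∏ₚ j _ (q ^ i) n) (∏ₚ-cong j (⟨p·⟩-⟨p·⟩ χ q i) n))) n)

-- The coefficient m(u - 1) + 1 of the equation, in the form in which the path sum weighs an up
-- step.
upWeight : K
upWeight = m′ * u′ + u′ + 1#

upWeight-≈ : m * (u - 1#) + 1# ≈ upWeight
upWeight-≈ = +-congʳ (begin
  -- Inserting `- 1# + 1#` turns m into m′ + 1; semiring laws then suffice, with `- 1#` as an atom.
  m * u′                       ≈⟨ *-congʳ (+-identityʳ m) ⟨
  (m + 0#) * u′                ≈⟨ *-congʳ (+-congˡ (-‿inverseˡ 1#)) ⟨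
  (m + (- 1# + 1#)) * u′       ≈⟨ solve 3 (λ m o u → (m :+ (o :+ con 1)) :* u := (m :+ o) :* u :+ u) ≈-refl m (- 1#) u′ ⟩
  m′ * u′ + u′                 ∎)
  where open K-Reasoning

m′*1/m′≈1 : m′ * 1/m′ ≈ 1#
m′*1/m′≈1 = Presentation.r-inverse

linear-solution : ∀ x y a b → x - m′ * y - a - b ≈ 0# → y ≈ 1/m′ * (x + (- a + - b))
linear-solution x y a b eq = begin
  y                                               ≈⟨ *-identityˡ y ⟨
  1# * y                                          ≈⟨ *-congʳ m′*1/m′≈1 ⟨
  m′ * 1/m′ * y                                   ≈⟨ solve 3 (λ m r y → m :* r :* y := r :* (con 0 :+ m :* y)) ≈-refl m′ 1/m′ y ⟩
  1/m′ * (0# + m′ * y)                            ≈⟨ *-congˡ (+-congʳ eq) ⟨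
  1/m′ * (x - m′ * y - a - b + m′ * y)            ≈⟨ *-congˡ (solve 5 (λ x z a b y → x :+ z :+ a :+ b :+ y := z :+ y :+ (x :+ (a :+ b))) ≈-refl x (- (m′ * y)) (- a) (- b) (m′ * y)) ⟩
  1/m′ * (- (m′ * y) + m′ * y + (x + (- a + - b))) ≈⟨ *-congˡ (+-congʳ (-‿inverseˡ (m′ * y))) ⟩
  1/m′ * (0# + (x + (- a + - b)))                 ≈⟨ *-congˡ (+-identityˡ _) ⟩
  1/m′ * (x + (- a + - b))                        ∎
  where open K-Reasoning

IsSolution : ℕ → Series → Set
IsSolution k χ =
  1ₚ -ₚ const (m - 1#) *ₚ χ
     -ₚ p *ₚ const q *ₚ (∏ₚ[ j < k ] (χ ⟨p· q ^ j ⟩))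
     -ₚ p *ₚ const (q ^ 2) *ₚ const (m * (u - 1#) + 1#) *ₚ (∏ₚ[ j < suc k ] (χ ⟨p· q ^ j ⟩))
    ≈ₚ 0ₚ

module Solution (k : ℕ) (χ : Series) (χ-solves : IsSolution k χ) where

  open K-Reasoning

  Q : ℕ → Series
  Q = qProduct χ

  h-term : p *ₚ const q *ₚ Q k ≈ₚ shift (q ·ₚ Q k)
  h-term n = begin
    (p *ₚ const q *ₚ Q k) n      ≈⟨ *ₚ-assoc p (const q) (Q k) n ⟩
    (p *ₚ (const q *ₚ Q k)) n    ≈⟨ p-*ₚ (const q *ₚ Q k) n ⟩
    shift (const q *ₚ Q k) n     ≈⟨ shift-cong (const-*ₚ q (Q k)) n ⟩
    shift (q ·ₚ Q k) n           ∎

  -- Only one factor of q² goes with p, as in `h-term`. The other stays with `upWeight` and becomes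
  -- the extra q that each U contributes to `d`.
  u-term : p *ₚ const (q ^ 2) *ₚ const (m * (u - 1#) + 1#) *ₚ Q (suc k)
             ≈ₚ shift (q ·ₚ ((q * upWeight) ·ₚ Q (suc k)))
  u-term n = begin
    (p *ₚ const (q ^ 2) *ₚ const c *ₚ X) n       ≈⟨ *ₚ-assoc (p *ₚ const (q ^ 2)) (const c) X n ⟩
    (p *ₚ const (q ^ 2) *ₚ (const c *ₚ X)) n     ≈⟨ *ₚ-assoc p (const (q ^ 2)) (const c *ₚ X) n ⟩
    (p *ₚ (const (q ^ 2) *ₚ (const c *ₚ X))) n   ≈⟨ p-*ₚ (const (q ^ 2) *ₚ (const c *ₚ X)) n ⟩
    shift (const (q ^ 2) *ₚ (const c *ₚ X)) n    ≈⟨ shift-cong coefficients n ⟩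
    shift (q ·ₚ ((q * upWeight) ·ₚ X)) n         ∎
    where
    c = m * (u - 1#) + 1#
    X = Q (suc k)
    coefficients : const (q ^ 2) *ₚ (const c *ₚ X) ≈ₚ q ·ₚ ((q * upWeight) ·ₚ X)
    coefficients n = begin
      (const (q ^ 2) *ₚ (const c *ₚ X)) n   ≈⟨ const-*ₚ (q ^ 2) (const c *ₚ X) n ⟩
      q ^ 2 * (const c *ₚ X) n              ≈⟨ *-congˡ (const-*ₚ c X n) ⟩
      q ^ 2 * (c * X n)                     ≈⟨ *-congˡ (*-congʳ upWeight-≈) ⟩
      q ^ 2 * (upWeight * X n)
        ≈⟨ solve 3 (λ q w x → q :* (q :* con 1) :* (w :* x) := q :* (q :* w :* x)) ≈-refl q upWeight (X n) ⟩
      q * (q * upWeight * X n)              ∎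

  functional : χ ≈ₚ 1/m′ ·ₚ (1ₚ +ₚ shift ((- q) ·ₚ (Q k +ₚ (q * upWeight) ·ₚ Q (suc k))))
  functional n = ≈-trans (linear-solution (1ₚ n) (χ n) _ _ coefficient) (*-congˡ (+-congˡ (negate n)))
    where
    negated : ∀ {a a′ b b′ c c′ d} → a ≈ a′ → b ≈ b′ → c ≈ c′ → d - a - b - c ≈ d - a′ - b′ - c′
    negated a b c = +-cong (+-cong (+-congˡ (-‿cong a)) (-‿cong b)) (-‿cong c)
    coefficient : 1ₚ n - m′ * χ n - shift (q ·ₚ Q k) n - shift (q ·ₚ ((q * upWeight) ·ₚ Q (suc k))) n ≈ 0#
    coefficient = ≈-trans
      (≈-sym (negated (const-*ₚ (m - 1#) χ n) (h-term n) (u-term n)))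
      (≈-trans (χ-solves n) (reflexive (0ₚ-coefficient n)))
      where
      0ₚ-coefficient : ∀ n → 0ₚ n ≡ 0#
      0ₚ-coefficient zero    = ≡.refl
      0ₚ-coefficient (suc _) = ≡.refl
    negate : ∀ n → - shift (q ·ₚ Q k) n + - shift (q ·ₚ ((q * upWeight) ·ₚ Q (suc k))) n
                 ≈ shift ((- q) ·ₚ (Q k +ₚ (q * upWeight) ·ₚ Q (suc k))) n
    negate zero    = ≈-trans (+-cong -0#≈0# -0#≈0#) (+-identityˡ 0#)
    negate (suc n) = ≈-trans (+-cong (-‿distribˡ-* q _) (-‿distribˡ-* q _)) (≈-sym (distribˡ (- q) _ _))

  -- The p in front of the products becomes pa: its scalar a joins `- q`, while the products inside
  -- are dilated in turn.
  functional-⟨p·⟩ : ∀ a → χ ⟨p· a ⟩ ≈ₚ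
    1/m′ ·ₚ (1ₚ +ₚ shift ((- q * a) ·ₚ ((Q k) ⟨p· a ⟩ +ₚ (q * upWeight) ·ₚ (Q (suc k)) ⟨p· a ⟩)))
  functional-⟨p·⟩ a zero    = ≈-trans (*-identityˡ (χ 0)) (functional 0)
  functional-⟨p·⟩ a (suc n) = ≈-trans (*-congˡ (functional (suc n)))
    (solve 7 (λ a aⁿ r s w x y → a :* aⁿ :* (r :* (con 0 :+ s :* (x :+ w :* y)))
                := r :* (con 0 :+ s :* a :* (aⁿ :* x :+ w :* (aⁿ :* y)))) ≈-refl
       a (a ^ n) 1/m′ (- q) (q * upWeight) (Q k n) (Q (suc k) n))

  Q-suc : ∀ e → Q (suc e) ≈ₚ
    1/m′ ·ₚ (Q e +ₚ shift ((- q * q ^ e) ·ₚ (Q (e +ℕ k) +ₚ (q * upWeight) ·ₚ Q (e +ℕ suc k))))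
  Q-suc e n = begin
    Q (suc e) n                                          ≈⟨ ∏ₚ-suc e _ n ⟩
    (Q e *ₚ χ ⟨p· q ^ e ⟩) n                             ≈⟨ *ₚ-cong {f = Q e} (λ _ → ≈-refl) (functional-⟨p·⟩ (q ^ e)) n ⟩
    (Q e *ₚ (1/m′ ·ₚ (1ₚ +ₚ shift (s ·ₚ G)))) n          ≈⟨ *ₚ-·ʳ 1/m′ (Q e) (1ₚ +ₚ shift (s ·ₚ G)) n ⟩
    1/m′ * (Q e *ₚ (1ₚ +ₚ shift (s ·ₚ G))) n             ≈⟨ *-congˡ (*ₚ-distribˡ (Q e) 1ₚ (shift (s ·ₚ G)) n) ⟩
    1/m′ * ((Q e *ₚ 1ₚ) n + (Q e *ₚ shift (s ·ₚ G)) n)   ≈⟨ *-congˡ (+-cong (*ₚ-identityʳ (Q e) n) (*ₚ-shift (Q e) (s ·ₚ G) n)) ⟩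
    1/m′ * (Q e n + shift (Q e *ₚ (s ·ₚ G)) n)           ≈⟨ *-congˡ (+-congˡ (shift-cong Q*G n)) ⟩
    1/m′ * (Q e n + shift (s ·ₚ (Q (e +ℕ k) +ₚ w ·ₚ Q (e +ℕ suc k))) n)  ∎
    where
    s = - q * q ^ e
    w = q * upWeight
    G = (Q k) ⟨p· q ^ e ⟩ +ₚ w ·ₚ (Q (suc k)) ⟨p· q ^ e ⟩
    Q*G : Q e *ₚ (s ·ₚ G) ≈ₚ s ·ₚ (Q (e +ℕ k) +ₚ w ·ₚ Q (e +ℕ suc k))
    Q*G n = begin
      (Q e *ₚ (s ·ₚ G)) n   ≈⟨ *ₚ-·ʳ s (Q e) G n ⟩
      s * (Q e *ₚ G) n      ≈⟨ *-congˡ (*ₚ-distribˡ (Q e) ((Q k) ⟨p· q ^ e ⟩) (w ·ₚ (Q (suc k)) ⟨p· q ^ e ⟩) n) ⟩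
      s * ((Q e *ₚ (Q k) ⟨p· q ^ e ⟩) n + (Q e *ₚ (w ·ₚ (Q (suc k)) ⟨p· q ^ e ⟩)) n)
        ≈⟨ *-congˡ (+-cong (qProduct-+ χ e k n) (≈-trans (*-congˡ (qProduct-+ χ e (suc k) n))
             (≈-sym (*ₚ-·ʳ w (Q e) ((Q (suc k)) ⟨p· q ^ e ⟩) n)))) ⟨
      s * (Q (e +ℕ k) n + w * Q (e +ℕ suc k) n)  ∎

-- The weighted number of paths with n steps U or H from excess e − 1 down to
-- excess 0; the convention at e = 0 makes a D step from excess 0 worthless.
V : ℕ → ℕ → ℕ → K
V k zero    zero    = 1#
V k zero    (suc n) = 0#
V k (suc e) zero    = V k e zero
V k (suc e) (suc n) =
  q ^ e * (q * upWeight) * V k (e +ℕ suc k) n + (V k e (suc n) + q ^ e * m′ * V k (e +ℕ k) n)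

module _ (k : ℕ) (χ : Series) (χ-solves : IsSolution k χ) where

  open Solution k χ χ-solves
  open K-Reasoning

  -- Every use of `Q-suc` costs one factor 1/m′, as every step of a path does. A path from excess e
  -- - 1, prolonged by a D to excess -1 and with each H counted as U D, has n steps U and kn + e
  -- steps D: this is the exponent. The induction is lexicographic in n and e, since a U or H raises
  -- e but lowers n.
  qProduct-coefficient : ∀ n e → qProduct χ e n ≈ (- q) ^ n * 1/m′ ^ ((k +ℕ 1) *ℕ n +ℕ e) * V k e n
  qProduct-coefficient zero    zero    rewrite ℕ.*-zeroʳ (k +ℕ 1) = solve 0 (con 1 := con 1 :* con 1 :* con 1) ≈-refl
  qProduct-coefficient zero    (suc e) = begin
    Q (suc e) 0                    ≈⟨ Q-suc e 0 ⟩
    1/m′ * (Q e 0 + 0#)            ≈⟨ *-congˡ (+-congʳ (qProduct-coefficient 0 e)) ⟩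
    1/m′ * (1# * 1/m′ ^ ((k +ℕ 1) *ℕ 0 +ℕ e) * V k e 0 + 0#)
      ≈⟨ solve 3 (λ r R v → r :* (con 1 :* R :* v :+ con 0) := con 1 :* (r :* R) :* v) ≈-refl 1/m′ _ _ ⟩
    1# * 1/m′ ^ suc ((k +ℕ 1) *ℕ 0 +ℕ e) * V k e 0
      ≡⟨ cong (λ i → 1# * 1/m′ ^ i * V k e 0) (ℕ.+-suc ((k +ℕ 1) *ℕ 0) e) ⟨
    1# * 1/m′ ^ ((k +ℕ 1) *ℕ 0 +ℕ suc e) * V k e 0  ∎
  -- The empty product is the series 1.
  qProduct-coefficient (suc n) zero    = ≈-sym (zeroʳ _)
  qProduct-coefficient (suc n) (suc e) = begin
    Q (suc e) (suc n)
      ≈⟨ Q-suc e (suc n) ⟩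
    1/m′ * (Q e (suc n) + - q * q ^ e * (Q (e +ℕ k) n + q * upWeight * Q (e +ℕ suc k) n))
      ≈⟨ *-congˡ (+-cong (≈-trans (qProduct-coefficient (suc n) e) (R-cong E₁))
           (*-congˡ (+-cong (≈-trans (qProduct-coefficient n (e +ℕ k)) (*-congʳ (*-congˡ R≈m′rR)))
              (*-congˡ (≈-trans (qProduct-coefficient n (e +ℕ suc k)) (R-cong E₂)))))) ⟩
    1/m′ * (- q * S * (1/m′ * R) * V₁ + - q * q ^ e * (S * (m′ * (1/m′ * R)) * V₂ + q * upWeight * (S * (1/m′ * R) * V₃)))
      ≈⟨ solve 10 (λ r s S R V₁ qᵉ m V₂ w V₃ →
           r :* (s :* S :* (r :* R) :* V₁ :+ s :* qᵉ :* (S :* (m :* (r :* R)) :* V₂ :+ w :* (S :* (r :* R) :* V₃)))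
           := s :* S :* (r :* (r :* R)) :* (qᵉ :* w :* V₃ :+ (V₁ :+ qᵉ :* m :* V₂))) ≈-refl
           1/m′ (- q) S R V₁ (q ^ e) m′ V₂ (q * upWeight) V₃ ⟩
    - q * S * (1/m′ * (1/m′ * R)) * V k (suc e) (suc n)
      ≈⟨ R-cong E₃ ⟨
    (- q) ^ suc n * 1/m′ ^ ((k +ℕ 1) *ℕ suc n +ℕ suc e) * V k (suc e) (suc n)  ∎
    where
    S = (- q) ^ n
    E = (k +ℕ 1) *ℕ n +ℕ (e +ℕ k)
    R = 1/m′ ^ E
    V₁ = V k e (suc n)
    V₂ = V k (e +ℕ k) n
    V₃ = V k (e +ℕ suc k) n
    R-cong : ∀ {x i j v} → i ≡ j → x * 1/m′ ^ i * v ≈ x * 1/m′ ^ j * v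
    R-cong i≡j = *-congʳ (*-congˡ (^-congʳ 1/m′ i≡j))
    -- H leads to Q_(e+k), which has one factor fewer than the Q_(e+k+1) of U, so its power of 1/m′
    -- is one short. Making up for it creates the m′ in the weight of H.
    R≈m′rR : R ≈ m′ * (1/m′ * R)
    R≈m′rR = ≈-sym (≈-trans (≈-sym (*-assoc m′ 1/m′ R)) (≈-trans (*-congʳ m′*1/m′≈1) (*-identityˡ R)))
    E₁ : (k +ℕ 1) *ℕ suc n +ℕ e ≡ suc E
    E₁ = ℕS.solve 3 (λ k n e → (k ℕS.:+ ℕS.con 1) ℕS.:* (ℕS.con 1 ℕS.:+ n) ℕS.:+ e
      ℕS.:= ℕS.con 1 ℕS.:+ ((k ℕS.:+ ℕS.con 1) ℕS.:* n ℕS.:+ (e ℕS.:+ k))) ≡.refl k n e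
    E₂ : (k +ℕ 1) *ℕ n +ℕ (e +ℕ suc k) ≡ suc E
    E₂ = ≡.trans (cong ((k +ℕ 1) *ℕ n +ℕ_) (ℕ.+-suc e k)) (ℕ.+-suc _ (e +ℕ k))
    E₃ : (k +ℕ 1) *ℕ suc n +ℕ suc e ≡ suc (suc E)
    E₃ = ≡.trans (ℕ.+-suc _ e) (cong suc E₁)

-- Sums over paths

∑-++ : ∀ {A : Set} (f : A → K) xs ys → ∑ (xs ++ ys) f ≈ ∑ xs f + ∑ ys f
∑-++ f []       ys = ≈-sym (+-identityˡ _)
∑-++ f (x ∷ xs) ys = ≈-trans (+-congˡ (∑-++ f xs ys)) (≈-sym (+-assoc (f x) _ _))

∑-*ˡ : ∀ {A : Set} c (f : A → K) xs → ∑[ x ← xs ] (c * f x) ≈ c * ∑ xs f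
∑-*ˡ c f []       = ≈-sym (zeroʳ c)
∑-*ˡ c f (x ∷ xs) = ≈-trans (+-congˡ (∑-*ˡ c f xs)) (≈-sym (distribˡ c _ _))

∑-cong-All : ∀ {A : Set} {f g : A → K} {xs} → All (λ x → f x ≈ g x) xs → ∑ xs f ≈ ∑ xs g
∑-cong-All []           = ≈-refl
∑-cong-All (eq ∷ eqs) = +-cong eq (∑-cong-All eqs)

∑-filter-map : ∀ {A B : Set} {P : B → Set} (P? : Decidable P) (g : A → B) (f : B → K) xs →
               ∑ (filter P? (map g xs)) f ≡ ∑ (filter (P? ∘ g) xs) (f ∘ g)
∑-filter-map P? g f []       = ≡.refl
∑-filter-map P? g f (x ∷ xs) with does (P? (g x))
... | true  = cong (f (g x) +_) (∑-filter-map P? g f xs)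
... | false = ∑-filter-map P? g f xs

∑-filter-none : ∀ {A : Set} {P : A → Set} (P? : Decidable P) (f : A → K) xs →
                (∀ x → ¬ P x) → ∑ (filter P? xs) f ≈ 0#
∑-filter-none P? f xs ¬P = reflexive (cong (λ ys → ∑ ys f) (filter-none P? (All.universal ¬P xs)))

-- Weighted sums over the paths from a given point

module Schröder (k-1 : ℕ) where

  open K-Reasoning

  k : ℕ
  k = suc k-1

  AboveFrom : Point → Path → Set
  AboveFrom P μ = All (λ (x , y) → x ≤ k *ℕ y) (pointsFrom P μ)

  aboveFrom? : ∀ P → Decidable (AboveFrom P)
  aboveFrom? P μ = all? (λ (x , y) → x ℕ.≤? k *ℕ y) (pointsFrom P μ)

  aboveFrom-start : ∀ {x y} μ → AboveFrom (x , y) μ → x ≤ k *ℕ y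
  aboveFrom-start []      (x≤ky ∷ _) = x≤ky
  aboveFrom-start (_ ∷ _) (x≤ky ∷ _) = x≤ky

  -- The exponent of q is the excess before the step, the length of the row of boxes that the step
  -- adds to the area.
  stepWeight : Step → Point → K
  stepWeight U (x , y) = q ^ (k *ℕ y ∸ x) * (q * upWeight)
  stepWeight D _       = 1#
  stepWeight H (x , y) = q ^ (k *ℕ y ∸ x) * m′

  weight : Point → Path → K
  weight P []      = 1#
  weight P (s ∷ μ) = stepWeight s P * weight (move s P) μ

  pathSum : Point → List Path → K
  pathSum P μs = ∑ (filter (aboveFrom? P) μs) (weight P)

  pathSum-++ : ∀ P μs νs → pathSum P (μs ++ νs) ≈ pathSum P μs + pathSum P νs
  pathSum-++ P μs νs = ≈-trans
    (reflexive (cong (λ ρs → ∑ ρs (weight P)) (filter-++ (aboveFrom? P) μs νs)))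
    (∑-++ (weight P) (filter (aboveFrom? P) μs) _)

  -- The longer path is tested at one more point, its start; `x ≤ k *ℕ y` settles that test, and the
  -- others are those of the tail.
  pathSum-step : ∀ s {x y} μs → x ≤ k *ℕ y →
                 pathSum (x , y) (map (s ∷_) μs) ≈ stepWeight s (x , y) * pathSum (move s (x , y)) μs
  pathSum-step s {x} {y} μs x≤ky = begin
    pathSum P (map (s ∷_) μs)
      ≡⟨ ∑-filter-map (aboveFrom? P) (s ∷_) (weight P) μs ⟩
    ∑ (filter (aboveFrom? P ∘ (s ∷_)) μs) (weight P ∘ (s ∷_))
      ≡⟨ cong (λ νs → ∑ νs (weight P ∘ (s ∷_)))
           (filter-≐ (aboveFrom? P ∘ (s ∷_)) (aboveFrom? (move s P)) (All.tail , (x≤ky ∷_)) μs) ⟩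
    ∑ (filter (aboveFrom? (move s P)) μs) (weight P ∘ (s ∷_))
      ≈⟨ ∑-*ˡ (stepWeight s P) (weight (move s P)) (filter (aboveFrom? (move s P)) μs) ⟩
    stepWeight s P * pathSum (move s P) μs  ∎
    where P = (x , y)

  pathSum-blocked : ∀ s P μs → (∀ μ → ¬ AboveFrom (move s P) μ) → pathSum P (map (s ∷_) μs) ≈ 0#
  pathSum-blocked s P μs blocked = ≈-trans
    (reflexive (∑-filter-map (aboveFrom? P) (s ∷_) (weight P) μs))
    (∑-filter-none (aboveFrom? P ∘ (s ∷_)) _ μs (λ μ → blocked μ ∘ All.tail))

  -- The first equation says that the start has excess e, the second that the end lies on the line y
  -- = x/k. Induction along the path keeps both true.
  pathSum≈V : ∀ a b {x y} e → x +ℕ e ≡ k *ℕ y → a ≡ k *ℕ b +ℕ e →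
              pathSum (x , y) (latticePaths a b) ≈ V k (suc e) b
  pathSum-D : ∀ a b {x y} e → x +ℕ e ≡ k *ℕ y → suc a ≡ k *ℕ b +ℕ e →
              pathSum (x , y) (map (D ∷_) (latticePaths a b)) ≈ V k e b

  pathSum≈V zero zero {x} {y} zero start end = begin
    ∑ (filter (aboveFrom? (x , y)) ([] ∷ [])) (weight (x , y))
      ≡⟨ cong (λ μs → ∑ μs (weight (x , y))) (filter-all (aboveFrom? (x , y)) ((x≤ky ∷ []) ∷ [])) ⟩
    1# + 0#  ≈⟨ +-identityʳ 1# ⟩
    1#       ∎
    where
    x≤ky : x ≤ k *ℕ y
    x≤ky = ℕ.≤-reflexive (≡.trans (≡.sym (ℕ.+-identityʳ x)) start)
  pathSum≈V zero zero (suc e) start end = contradiction (≡.trans end (ℕ.+-suc (k *ℕ 0) e)) λ ()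
  -- As k is a successor, a positive height still to climb forces a positive width.
  pathSum≈V zero (suc b) e start ()
  pathSum≈V (suc a) zero e start end = pathSum-D a zero e start end
  pathSum≈V (suc a) (suc b) {x} {y} e start end = begin
    pathSum P (map (U ∷_) μU ++ map (D ∷_) μD ++ map (H ∷_) μH)
      ≈⟨ pathSum-++ P (map (U ∷_) μU) _ ⟩
    pathSum P (map (U ∷_) μU) + pathSum P (map (D ∷_) μD ++ map (H ∷_) μH)
      ≈⟨ +-congˡ (pathSum-++ P (map (D ∷_) μD) _) ⟩
    pathSum P (map (U ∷_) μU) + (pathSum P (map (D ∷_) μD) + pathSum P (map (H ∷_) μH))
      ≈⟨ +-cong (pathSum-step U μU x≤ky) (+-cong (pathSum-D a (suc b) e start end) (pathSum-step H μH x≤ky)) ⟩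
    q ^ (k *ℕ y ∸ x) * (q * upWeight) * pathSum (x , suc y) μU
      + (V k e (suc b) + q ^ (k *ℕ y ∸ x) * m′ * pathSum (suc x , suc y) μH)
      ≈⟨ +-cong (*-cong (*-congʳ q^excess) (pathSum≈V (suc a) b (e +ℕ k) startU endU))
           (+-congˡ (*-cong (*-congʳ q^excess) (pathSum≈V a b (e +ℕ k-1) startH endH))) ⟩
    q ^ e * (q * upWeight) * V k (suc (e +ℕ k)) b + (V k e (suc b) + q ^ e * m′ * V k (suc (e +ℕ k-1)) b)
      ≡⟨ cong₂ (λ i j → q ^ e * (q * upWeight) * V k i b + (V k e (suc b) + q ^ e * m′ * V k j b))
           (ℕ.+-suc e k) (ℕ.+-suc e k-1) ⟨
    V k (suc e) (suc b)  ∎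
    where
    P = (x , y)
    μU = latticePaths (suc a) b
    μD = latticePaths a (suc b)
    μH = latticePaths a b
    x≤ky : x ≤ k *ℕ y
    x≤ky = ℕ.≤-trans (ℕ.m≤m+n x e) (ℕ.≤-reflexive start)
    q^excess : q ^ (k *ℕ y ∸ x) ≈ q ^ e
    q^excess = ^-congʳ q (≡.trans (cong (_∸ x) (≡.sym start)) (ℕ.m+n∸m≡n x e))
    startU : x +ℕ (e +ℕ k) ≡ k *ℕ suc y
    startU = ≡.trans (≡.sym (ℕ.+-assoc x e k))
      (≡.trans (cong (_+ℕ k) start) (≡.trans (ℕ.+-comm (k *ℕ y) k) (≡.sym (ℕ.*-suc k y))))
    startH : suc x +ℕ (e +ℕ k-1) ≡ k *ℕ suc y
    startH = ≡.trans (≡.sym (ℕ.+-suc x (e +ℕ k-1)))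
      (≡.trans (cong (x +ℕ_) (≡.sym (ℕ.+-suc e k-1))) startU)
    endU : suc a ≡ k *ℕ b +ℕ (e +ℕ k)
    endU = ≡.trans end (ℕS.solve 3 (λ k b e →
      k ℕS.:* (ℕS.con 1 ℕS.:+ b) ℕS.:+ e ℕS.:= k ℕS.:* b ℕS.:+ (e ℕS.:+ k)) ≡.refl k b e)
    endH : a ≡ k *ℕ b +ℕ (e +ℕ k-1)
    endH = ℕ.suc-injective (≡.trans endU
      (≡.trans (cong (k *ℕ b +ℕ_) (ℕ.+-suc e k-1)) (ℕ.+-suc (k *ℕ b) (e +ℕ k-1))))

  -- `V k 0 0` is 1 and not 0, but the case is void: at excess 0 with no height left to climb, the
  -- end is reached and no D remains.
  pathSum-D a zero    zero start end = contradiction (≡.trans end (≡.trans (ℕ.+-identityʳ (k *ℕ 0)) (ℕ.*-zeroʳ k))) λ ()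
  -- D from excess 0 falls below the line at once, in accordance with `V k 0 (suc b)` being 0.
  pathSum-D a (suc b) {x} {y} zero start end = pathSum-blocked D (x , y) (latticePaths a (suc b))
    λ μ above → ℕ.<-irrefl (≡.trans (≡.sym (ℕ.+-identityʳ x)) start) (aboveFrom-start μ above)
  pathSum-D a b {x} {y} (suc e) start end = begin
    pathSum (x , y) (map (D ∷_) (latticePaths a b))   ≈⟨ pathSum-step D (latticePaths a b) x≤ky ⟩
    1# * pathSum (suc x , y) (latticePaths a b)       ≈⟨ *-identityˡ _ ⟩
    pathSum (suc x , y) (latticePaths a b)
      ≈⟨ pathSum≈V a b e (≡.trans (≡.sym (ℕ.+-suc x e)) start) (ℕ.suc-injective (≡.trans end (ℕ.+-suc (k *ℕ b) e))) ⟩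
    V k (suc e) b                                     ∎
    where
    x≤ky : x ≤ k *ℕ y
    x≤ky = ℕ.≤-trans (ℕ.m≤m+n x (suc e)) (ℕ.≤-reflexive start)

-- Area

rise : Path → ℕ
rise []      = 0
rise (U ∷ μ) = suc (rise μ)
rise (D ∷ μ) = rise μ
rise (H ∷ μ) = suc (rise μ)

rise≡N : ∀ μ → rise μ ≡ N U μ +ℕ N H μ
rise≡N []      = ≡.refl
rise≡N (U ∷ μ) = cong suc (rise≡N μ)
rise≡N (D ∷ μ) = rise≡N μ
rise≡N (H ∷ μ) = ≡.trans (cong suc (rise≡N μ)) (≡.sym (ℕ.+-suc (N U μ) (N H μ)))

latticePaths-rise : ∀ a b → All (λ μ → rise μ ≡ b) (latticePaths a b)
latticePaths-rise zero    zero    = ≡.refl ∷ []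
latticePaths-rise zero    (suc b) = map⁺ (All.map (cong suc) (latticePaths-rise zero b))
latticePaths-rise (suc a) zero    = map⁺ (latticePaths-rise a zero)
latticePaths-rise (suc a) (suc b) =
  ++⁺ (map⁺ (All.map (cong suc) (latticePaths-rise (suc a) b)))
    (++⁺ (map⁺ (latticePaths-rise a (suc b))) (map⁺ (All.map (cong suc) (latticePaths-rise a b))))

-- Each U or H step at (x , y) contributes its row of boxes, [x, k y) × {y}.
areaFrom : ℕ → Point → Path → ℕ
areaFrom k P       []      = 0
areaFrom k (x , y) (U ∷ μ) = (k *ℕ y ∸ x) +ℕ areaFrom k (x , suc y) μ
areaFrom k (x , y) (D ∷ μ) = areaFrom k (suc x , y) μ
areaFrom k (x , y) (H ∷ μ) = (k *ℕ y ∸ x) +ℕ areaFrom k (suc x , suc y) μ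

-- The left end is explicit, so that an induction along a path can strip off the lowest remaining
-- row.
range : ℕ → ℕ → List ℕ
range y zero    = []
range y (suc b) = y ∷ range (suc y) b

map-suc-range : ∀ y b → map suc (range y b) ≡ range (suc y) b
map-suc-range y zero    = ≡.refl
map-suc-range y (suc b) = cong (suc y ∷_) (map-suc-range (suc y) b)

upTo≡range : ∀ n → upTo n ≡ range 0 n
upTo≡range zero    = ≡.refl
upTo≡range (suc n) = cong (0 ∷_) (≡.trans (≡.sym (map-upTo suc n))
  (≡.trans (cong (map suc) (upTo≡range n)) (map-suc-range 0 n)))

range-≥ : ∀ y b → All (y ≤_) (range y b)
range-≥ y zero    = []
range-≥ y (suc b) = ℕ.≤-refl ∷ All.map ℕ.<⇒≤ (range-≥ (suc y) b)

range-< : ∀ y b → All (_< y +ℕ b) (range y b)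
range-< y zero    = []
range-< y (suc b) = ℕ.m<m+n y (s≤s z≤n)
  ∷ All.map (λ {j} j< → ≡.subst (j <_) (≡.sym (ℕ.+-suc y b)) j<) (range-< (suc y) b)

-- Counting in intervals and in products

length-filter-map : ∀ {A B : Set} {P : B → Set} (P? : Decidable P) (g : A → B) xs →
                    length (filter P? (map g xs)) ≡ length (filter (P? ∘ g) xs)
length-filter-map P? g []       = ≡.refl
length-filter-map P? g (x ∷ xs) with does (P? (g x))
... | true  = cong suc (length-filter-map P? g xs)
... | false = length-filter-map P? g xs

length-filter-interval : ∀ a b n → length (filter (λ i → a ℕ.≤? i ×-dec i ℕ.<? b) (upTo n)) ≡ (b ⊓ n) ∸ a
length-filter-interval a b zero rewrite ℕ.⊓-zeroʳ b = ≡.sym (ℕ.0∸n≡0 a)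
length-filter-interval a zero (suc n) = ≡.trans
  (cong length (filter-none (λ i → a ℕ.≤? i ×-dec i ℕ.<? 0) (All.universal (λ { _ (_ , ()) }) (upTo (suc n)))))
  (≡.sym (ℕ.0∸n≡0 a))
length-filter-interval a (suc b) (suc n) = ≡.trans (cong (λ xs → length (filter P? (0 ∷ xs))) (≡.sym (map-upTo suc n))) (by-cases a)
  where
  P? : Decidable (λ i → a ≤ i × i < suc b)
  P? i = a ℕ.≤? i ×-dec i ℕ.<? suc b
  by-cases : ∀ a → length (filter (λ i → a ℕ.≤? i ×-dec i ℕ.<? suc b) (0 ∷ map suc (upTo n))) ≡ suc (b ⊓ n) ∸ a
  by-cases zero = cong suc (≡.trans (length-filter-map (λ i → 0 ℕ.≤? i ×-dec i ℕ.<? suc b) suc (upTo n))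
    (≡.trans (cong length (filter-≐ _ (λ i → 0 ℕ.≤? i ×-dec i ℕ.<? b)
      ((λ { (_ , s≤s i<b) → z≤n , i<b }) , (λ { (_ , i<b) → z≤n , s≤s i<b })) (upTo n)))
      (length-filter-interval 0 b n)))
  by-cases (suc a) = ≡.trans (length-filter-map (λ i → suc a ℕ.≤? i ×-dec i ℕ.<? suc b) suc (upTo n))
    (≡.trans (cong length (filter-≐ _ (λ i → a ℕ.≤? i ×-dec i ℕ.<? b)
      ((λ { (s≤s a≤i , s≤s i<b) → a≤i , i<b }) , (λ { (a≤i , i<b) → s≤s a≤i , s≤s i<b })) (upTo n)))
      (length-filter-interval a b n))

sum-map-const-0 : ∀ {A : Set} (ys : List A) → sum (map (λ _ → 0) ys) ≡ 0
sum-map-const-0 []       = ≡.refl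
sum-map-const-0 (_ ∷ ys) = sum-map-const-0 ys

-- The product is listed column by column, while the area is wanted row by row; each new column adds
-- at most one element to every row.
length-filter-cartesianProduct : ∀ {A B : Set} {P : A × B → Set} (P? : Decidable P) xs ys →
  length (filter P? (cartesianProduct xs ys)) ≡ sum (map (λ y → length (filter (λ x → P? (x , y)) xs)) ys)
length-filter-cartesianProduct P? []       ys = ≡.sym (sum-map-const-0 ys)
length-filter-cartesianProduct P? (x ∷ xs) ys = begin
  length (filter P? (map (x ,_) ys ++ cartesianProduct xs ys))
    ≡⟨ cong length (filter-++ P? (map (x ,_) ys) (cartesianProduct xs ys)) ⟩
  length (filter P? (map (x ,_) ys) ++ filter P? (cartesianProduct xs ys))
    ≡⟨ length-++ (filter P? (map (x ,_) ys)) ⟩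
  length (filter P? (map (x ,_) ys)) +ℕ length (filter P? (cartesianProduct xs ys))
    ≡⟨ cong (length (filter P? (map (x ,_) ys)) +ℕ_) (length-filter-cartesianProduct P? xs ys) ⟩
  length (filter P? (map (x ,_) ys)) +ℕ sum (map (row xs) ys)
    ≡⟨ column ys ⟩
  sum (map (row (x ∷ xs)) ys)  ∎
  where
  open ≡.≡-Reasoning
  row : List _ → _ → ℕ
  row xs y = length (filter (λ x → P? (x , y)) xs)
  column : ∀ ys → length (filter P? (map (x ,_) ys)) +ℕ sum (map (row xs) ys) ≡ sum (map (row (x ∷ xs)) ys)
  column [] = ≡.refl
  column (y ∷ ys) with does (P? (x , y)) | column ys
  ... | true  | ih = cong suc (≡.trans (x+[y+z]≡y+[x+z] (length (filter P? (map (x ,_) ys))) (row xs y) _) (cong (row xs y +ℕ_) ih))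
  ... | false | ih = ≡.trans (x+[y+z]≡y+[x+z] (length (filter P? (map (x ,_) ys))) (row xs y) _) (cong (row xs y +ℕ_) ih)

-- Boxes above the lowest path

pointsFrom-start : ∀ {R : Point → Set} {P} μ → R P → Any R (pointsFrom P μ)
pointsFrom-start []      r = here r
pointsFrom-start (_ ∷ _) r = here r

lowest-above : ∀ k b {x y} → x ≤ k *ℕ y → All (λ (x , y) → x ≤ k *ℕ y) (pointsFrom (x , y) (lowest k b))
lowest-above k zero    x≤ky = x≤ky ∷ []
lowest-above k (suc b) {x} {y} x≤ky = x≤ky ∷ downs k (≡.subst (k +ℕ x ≤_) (≡.sym (ℕ.*-suc k y)) (ℕ.+-monoʳ-≤ k x≤ky))
  where
  -- With `l` steps D left in the block, the bound reserves room for all of them.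
  downs : ∀ l {x y} → l +ℕ x ≤ k *ℕ y → All (λ (x , y) → x ≤ k *ℕ y) (pointsFrom (x , y) (replicate l D ++ lowest k b))
  downs zero    x≤ky = lowest-above k b x≤ky
  downs (suc l) {x} {y} l+x≤ky = ℕ.≤-trans (ℕ.m≤n+m x (suc l)) l+x≤ky
    ∷ downs l (≡.subst (_≤ k *ℕ y) (≡.sym (ℕ.+-suc l x)) l+x≤ky)

-- After t whole blocks the path has moved by (kt, t). From the origin these are its points on the
-- line, the witnesses for `boxAbove-lowest`.
lowest-corner : ∀ k b t {x y} → t ≤ b → Any (_≡ (k *ℕ t +ℕ x , t +ℕ y)) (pointsFrom (x , y) (lowest k b))
lowest-corner k b       zero {x} {y} z≤n = pointsFrom-start (lowest k b) (cong (λ z → z +ℕ x , y) (≡.sym (ℕ.*-zeroʳ k)))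
lowest-corner k (suc b) (suc t) {x} {y} (s≤s t≤b) = there (downs k (cong₂ _,_
  (≡.trans (≡.sym (ℕ.+-assoc (k *ℕ t) k x)) (cong (_+ℕ x) (≡.trans (ℕ.+-comm (k *ℕ t) k) (≡.sym (ℕ.*-suc k t)))))
  (ℕ.+-suc t y)))
  where
  downs : ∀ l {x y P} → (k *ℕ t +ℕ (l +ℕ x) , t +ℕ y) ≡ P →
          Any (_≡ P) (pointsFrom (x , y) (replicate l D ++ lowest k b))
  downs zero            ≡.refl = lowest-corner k b t t≤b
  downs (suc l) {x} {y} ≡.refl = there (downs l (cong (λ i → k *ℕ t +ℕ i , t +ℕ y) (ℕ.+-suc l x)))

-- The lowest path never crosses the line, so at height at most j it reaches no further right than k
-- j; its corner (k j, j) attains this bound.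
boxAbove-lowest : ∀ k n {i j} → j ≤ n → BoxAbove (lowest k n) (i , j) ⇔ i < k *ℕ j
boxAbove-lowest k n {i} {j} j≤n = mk⇔ to from
  where
  to : BoxAbove (lowest k n) (i , j) → i < k *ℕ j
  to above with lookupAny (lowest-above k n z≤n) above
  ... | x≤ky , i<x , y≤j = ℕ.<-≤-trans i<x (ℕ.≤-trans x≤ky (ℕ.*-monoʳ-≤ k y≤j))
  from : i < k *ℕ j → BoxAbove (lowest k n) (i , j)
  from i<kj = Any.map
    (λ { ≡.refl → ≡.subst (i <_) (≡.sym (ℕ.+-identityʳ (k *ℕ j))) i<kj , ℕ.≤-reflexive (ℕ.+-identityʳ j) })
    (lowest-corner k n j j≤n)

-- Rows of boxes between the two paths

pointsFrom-right : ∀ {x y z} μ → z ≤ x → All (λ P → z ≤ proj₁ P) (pointsFrom (x , y) μ)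
pointsFrom-right []      z≤x = z≤x ∷ []
pointsFrom-right (U ∷ μ) z≤x = z≤x ∷ pointsFrom-right μ z≤x
pointsFrom-right (D ∷ μ) z≤x = z≤x ∷ pointsFrom-right μ (ℕ.m≤n⇒m≤1+n z≤x)
pointsFrom-right (H ∷ μ) z≤x = z≤x ∷ pointsFrom-right μ (ℕ.m≤n⇒m≤1+n z≤x)

module _ (k n : ℕ) where

  open ≡.≡-Reasoning

  Below : List Point → Point → Set
  Below Ps (i , j) = Any (λ (x , y) → x ≤ i × j < y) Ps

  rowLength : List Point → ℕ → ℕ
  rowLength Ps j = length (filter
    (λ i → any? (λ (x , y) → x ℕ.≤? i ×-dec j ℕ.<? y) Ps ×-dec i ℕ.<? k *ℕ j) (upTo (k *ℕ n)))

  -- A box of row j is below the path only through a point strictly higher than j.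
  rowLength-∷ : ∀ {x y j} Ps → y ≤ j → rowLength ((x , y) ∷ Ps) j ≡ rowLength Ps j
  rowLength-∷ {x} {y} {j} Ps y≤j = cong length (filter-≐ _ _ (to , from) (upTo (k *ℕ n)))
    where
    to : ∀ {i} → Below ((x , y) ∷ Ps) (i , j) × i < k *ℕ j → Below Ps (i , j) × i < k *ℕ j
    to (here (_ , j<y) , _)  = contradiction y≤j (ℕ.<⇒≱ j<y)
    to (there below , i<kj)  = below , i<kj
    from : ∀ {i} → Below Ps (i , j) × i < k *ℕ j → Below ((x , y) ∷ Ps) (i , j) × i < k *ℕ j
    from (below , i<kj) = there below , i<kj

  -- Among the points above height y the first, (x, y + 1), is leftmost, so it alone decides which
  -- boxes of row y are below the path. The bound `y ≤ n` keeps the row inside the grid.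
  rowLength-up : ∀ {x y} μ → y ≤ n → rowLength ((x , y) ∷ pointsFrom (x , suc y) μ) y ≡ k *ℕ y ∸ x
  rowLength-up {x} {y} μ y≤n = begin
    rowLength ((x , y) ∷ Ps) y
      ≡⟨ cong length (filter-≐ _ (λ i → x ℕ.≤? i ×-dec i ℕ.<? k *ℕ y) (to , from) (upTo (k *ℕ n))) ⟩
    length (filter (λ i → x ℕ.≤? i ×-dec i ℕ.<? k *ℕ y) (upTo (k *ℕ n)))
      ≡⟨ length-filter-interval x (k *ℕ y) (k *ℕ n) ⟩
    (k *ℕ y) ⊓ (k *ℕ n) ∸ x
      ≡⟨ cong (_∸ x) (ℕ.m≤n⇒m⊓n≡m (ℕ.*-monoʳ-≤ k y≤n)) ⟩
    k *ℕ y ∸ x  ∎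
    where
    Ps = pointsFrom (x , suc y) μ
    to : ∀ {i} → Below ((x , y) ∷ Ps) (i , y) × i < k *ℕ y → x ≤ i × i < k *ℕ y
    to (below , i<ky) with lookupAny (ℕ.≤-refl ∷ pointsFrom-right μ ℕ.≤-refl) below
    ... | x≤x′ , x′≤i , _ = ℕ.≤-trans x≤x′ x′≤i , i<ky
    from : ∀ {i} → x ≤ i × i < k *ℕ y → Below ((x , y) ∷ Ps) (i , y) × i < k *ℕ y
    from (x≤i , i<ky) = there (pointsFrom-start μ (x≤i , ℕ.≤-refl)) , i<ky

  rowLengths : List Point → ℕ → ℕ → ℕ
  rowLengths Ps y b = sum (map (rowLength Ps) (range y b))

  rowLengths-∷ : ∀ {x y y′} b Ps → y ≤ y′ → rowLengths ((x , y) ∷ Ps) y′ b ≡ rowLengths Ps y′ b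
  rowLengths-∷ {y′ = y′} b Ps y≤y′ = cong sum (map-cong-local
    (All.map (λ y′≤j → rowLength-∷ Ps (ℕ.≤-trans y≤y′ y′≤j)) (range-≥ y′ b)))

  rowLengths-tilde : ∀ μ {x y} → y +ℕ rise μ ≤ n →
                     rowLengths (pointsFrom (x , y) (tilde μ)) y (rise μ) ≡ areaFrom k (x , y) μ
  rowLengths-tilde []      y≤n = ≡.refl
  rowLengths-tilde (U ∷ μ) {x} {y} y≤n = cong₂ _+ℕ_
    (rowLength-up (tilde μ) (ℕ.m+n≤o⇒m≤o y y≤n))
    (≡.trans (rowLengths-∷ (rise μ) (pointsFrom (x , suc y) (tilde μ)) (ℕ.n≤1+n y))
      (rowLengths-tilde μ (≡.subst (_≤ n) (ℕ.+-suc y (rise μ)) y≤n)))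
  rowLengths-tilde (D ∷ μ) {x} {y} y≤n = ≡.trans
    (rowLengths-∷ (rise μ) (pointsFrom (suc x , y) (tilde μ)) ℕ.≤-refl)
    (rowLengths-tilde μ y≤n)
  rowLengths-tilde (H ∷ μ) {x} {y} y≤n = cong₂ _+ℕ_
    -- H has become U D: U accounts for the row, and the intermediate point is dropped together with
    -- the start.
    (rowLength-up (D ∷ tilde μ) (ℕ.m+n≤o⇒m≤o y y≤n))
    (≡.trans (rowLengths-∷ (rise μ) _ (ℕ.n≤1+n y))
      (≡.trans (rowLengths-∷ (rise μ) (pointsFrom (suc x , suc y) (tilde μ)) ℕ.≤-refl)
        (rowLengths-tilde μ (≡.subst (_≤ n) (ℕ.+-suc y (rise μ)) y≤n))))

  Area-tilde : ∀ μ → rise μ ≡ n → Area k n (tilde μ) ≡ areaFrom k (0 , 0) μ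
  Area-tilde μ rise≡n = begin
    Area k n (tilde μ)
      ≡⟨ length-filter-cartesianProduct
           (λ b → boxBelow? (tilde μ) b ×-dec boxAbove? (lowest k n) b) (upTo (k *ℕ n)) (upTo n) ⟩
    sum (map row (upTo n))
      ≡⟨ cong (sum ∘ map row) (upTo≡range n) ⟩
    sum (map row (range 0 n))
      ≡⟨ cong sum (map-cong-local (All.map row≡rowLength (range-< 0 n))) ⟩
    rowLengths (points (tilde μ)) 0 n
      ≡⟨ cong (rowLengths (points (tilde μ)) 0) rise≡n ⟨
    rowLengths (points (tilde μ)) 0 (rise μ)
      ≡⟨ rowLengths-tilde μ (ℕ.≤-reflexive rise≡n) ⟩
    areaFrom k (0 , 0) μ  ∎
    where
    row : ℕ → ℕ
    row j = length (filter (λ i → boxBelow? (tilde μ) (i , j) ×-dec boxAbove? (lowest k n) (i , j)) (upTo (k *ℕ n)))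
    row≡rowLength : ∀ {j} → j < n → row j ≡ rowLength (points (tilde μ)) j
    row≡rowLength {j} j<n = cong length (filter-≐ _ _
      ( (λ (below , above) → below , Equivalence.to (boxAbove-lowest k n (ℕ.<⇒≤ j<n)) above)
      , (λ (below , i<kj) → below , Equivalence.from (boxAbove-lowest k n (ℕ.<⇒≤ j<n)) i<kj)) (upTo (k *ℕ n)))

  -- U and H steps together number n, so n - N(H) is N(U) and the truncated subtraction is exact.
  d≡areaFrom+N : ∀ μ → rise μ ≡ n → d k n μ ≡ areaFrom k (0 , 0) μ +ℕ N U μ
  d≡areaFrom+N μ rise≡n = begin
    (Area k n (tilde μ) +ℕ n) ∸ N H μ
      ≡⟨ cong₂ (λ a b → (a +ℕ b) ∸ N H μ) (Area-tilde μ rise≡n) (≡.trans (≡.sym rise≡n) (rise≡N μ)) ⟩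
    (areaFrom k (0 , 0) μ +ℕ (N U μ +ℕ N H μ)) ∸ N H μ
      ≡⟨ cong (_∸ N H μ) (ℕ.+-assoc (areaFrom k (0 , 0) μ) (N U μ) (N H μ)) ⟨
    ((areaFrom k (0 , 0) μ +ℕ N U μ) +ℕ N H μ) ∸ N H μ
      ≡⟨ ℕ.m+n∸n≡m _ (N H μ) ⟩
    areaFrom k (0 , 0) μ +ℕ N U μ  ∎

-- The powers of q from the excesses add up to the area, and the extra q of each U supplies the
-- exponent `N U μ`.
weight-closed : ∀ k-1 P μ → let open Schröder k-1 in
                weight P μ ≈ m′ ^ N H μ * upWeight ^ N U μ * q ^ (areaFrom k P μ +ℕ N U μ)
weight-closed k-1 P [] = solve 0 (con 1 := con 1 :* con 1 :* con 1) ≈-refl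
weight-closed k-1 (x , y) (U ∷ μ) = begin
  q ^ e * (q * upWeight) * weight (x , suc y) μ
    ≈⟨ *-congˡ (weight-closed k-1 (x , suc y) μ) ⟩
  q ^ e * (q * upWeight) * (m′ ^ N H μ * upWeight ^ N U μ * q ^ E)
    ≈⟨ solve 6 (λ qᵉ q w M W Q → qᵉ :* (q :* w) :* (M :* W :* Q) := M :* (w :* W) :* (q :* (qᵉ :* Q))) ≈-refl
         (q ^ e) q upWeight (m′ ^ N H μ) (upWeight ^ N U μ) (q ^ E) ⟩
  m′ ^ N H μ * upWeight ^ suc (N U μ) * (q * (q ^ e * q ^ E))
    ≈⟨ *-congˡ (*-congˡ (^-homo-* q e E)) ⟨
  m′ ^ N H μ * upWeight ^ suc (N U μ) * q ^ suc (e +ℕ E)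
    ≡⟨ cong (λ i → m′ ^ N H μ * upWeight ^ suc (N U μ) * q ^ i)
         (≡.trans (ℕ.+-suc (e +ℕ areaFrom k (x , suc y) μ) (N U μ)) (cong suc (ℕ.+-assoc e _ (N U μ)))) ⟨
  m′ ^ N H μ * upWeight ^ suc (N U μ) * q ^ (e +ℕ areaFrom k (x , suc y) μ +ℕ suc (N U μ))  ∎
  where
  open Schröder k-1
  open K-Reasoning
  e = k *ℕ y ∸ x
  E = areaFrom k (x , suc y) μ +ℕ N U μ
weight-closed k-1 (x , y) (D ∷ μ) = ≈-trans (*-identityˡ _) (weight-closed k-1 (suc x , y) μ)
weight-closed k-1 (x , y) (H ∷ μ) = begin
  q ^ e * m′ * weight (suc x , suc y) μ
    ≈⟨ *-congˡ (weight-closed k-1 (suc x , suc y) μ) ⟩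
  q ^ e * m′ * (m′ ^ N H μ * upWeight ^ N U μ * q ^ E)
    ≈⟨ solve 5 (λ qᵉ m M W Q → qᵉ :* m :* (M :* W :* Q) := m :* M :* W :* (qᵉ :* Q)) ≈-refl
         (q ^ e) m′ (m′ ^ N H μ) (upWeight ^ N U μ) (q ^ E) ⟩
  m′ ^ suc (N H μ) * upWeight ^ N U μ * (q ^ e * q ^ E)
    ≈⟨ *-congˡ (^-homo-* q e E) ⟨
  m′ ^ suc (N H μ) * upWeight ^ N U μ * q ^ (e +ℕ E)
    ≡⟨ cong (λ i → m′ ^ suc (N H μ) * upWeight ^ N U μ * q ^ i) (ℕ.+-assoc e _ (N U μ)) ⟨
  m′ ^ suc (N H μ) * upWeight ^ N U μ * q ^ (e +ℕ areaFrom k (suc x , suc y) μ +ℕ N U μ)  ∎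
  where
  open Schröder k-1
  open K-Reasoning
  e = k *ℕ y ∸ x
  E = areaFrom k (suc x , suc y) μ +ℕ N U μ

-- From path sums to the coefficients of χ

SchB-sum : ∀ k n → 1 ≤ k →
  ∑[ μ ← SchB n k ] (m′ ^ N H μ * (m′ * u′ + u′ + 1#) ^ N U μ * q ^ d k n μ) ≈ V k 1 n
SchB-sum k@(suc k-1) n _ = ≈-trans
  (∑-cong-All (filter⁺ (aboveLine? k) (All.map weights (latticePaths-rise (k *ℕ n) n))))
  -- The origin has excess 0, hence the index 1 of `V`.
  (pathSum≈V (k *ℕ n) n {0} {0} 0 (≡.sym (ℕ.*-zeroʳ k)) (≡.sym (ℕ.+-identityʳ (k *ℕ n))))
  where
  open Schröder k-1 using (weight; pathSum≈V)
  weights : ∀ {μ} → rise μ ≡ n →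
    m′ ^ N H μ * (m′ * u′ + u′ + 1#) ^ N U μ * q ^ d k n μ ≈ weight (0 , 0) μ
  weights {μ} rise≡n = ≈-sym (≈-trans (weight-closed k-1 (0 , 0) μ)
    (*-congˡ (^-congʳ q (≡.sym (d≡areaFrom+N k n μ rise≡n)))))

proposition4p10 : (k : ℕ) → 1 ≤ k →
    (χ : Series) →
    1ₚ -ₚ const (m - 1#) *ₚ χ
    -ₚ p *ₚ const q *ₚ (∏ₚ[ j < k ] (χ ⟨p· q ^ j ⟩))
    -ₚ p *ₚ const (q ^ 2) *ₚ const (m * (u - 1#) + 1#) *ₚ (∏ₚ[ j < suc k ] (χ ⟨p· q ^ j ⟩))
    ≈ₚ 0ₚ →
    χ ≈ₚ λ n →
    (- q) ^ n * 1/m′ ^ ((k +ℕ 1) *ℕ n +ℕ 1)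
    * (∑[ μ ← SchB n k ] (m′ ^ N H μ * (m′ * u′ + u′ + 1#) ^ N U μ * q ^ d k n μ))
proposition4p10 k 1≤k χ χ-solves n = begin
  χ n                      ≈⟨ *-identityˡ (χ n) ⟨
  1# * χ n                 ≈⟨ *-congʳ (1^n≈1 n) ⟨
  (χ ⟨p· q ^ 0 ⟩) n        ≈⟨ *ₚ-identityʳ (χ ⟨p· q ^ 0 ⟩) n ⟨
  qProduct χ 1 n           ≈⟨ qProduct-coefficient k χ χ-solves n 1 ⟩
  (- q) ^ n * 1/m′ ^ ((k +ℕ 1) *ℕ n +ℕ 1) * V k 1 n  ≈⟨ *-congˡ (SchB-sum k n 1≤k) ⟨
  (- q) ^ n * 1/m′ ^ ((k +ℕ 1) *ℕ n +ℕ 1)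
    * (∑[ μ ← SchB n k ] (m′ ^ N H μ * (m′ * u′ + u′ + 1#) ^ N U μ * q ^ d k n μ))  ∎
  where
  open K-Reasoning
  1^n≈1 : ∀ n → 1# ^ n ≈ 1#
  1^n≈1 zero    = ≈-refl
  1^n≈1 (suc n) = ≈-trans (*-identityˡ _) (1^n≈1 n)
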